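{- Let $n$ be a positive integer with $n \equiv 3 \pmod 6$ and \[n \notin \{9, 15, 21, 141, 153, 165, 177, 189, 231, 249, 261, 285, 351, 357\},\] and let $\rho$ be an integer with $1 \le \rho \le n/3$. Then there exists an $(n+\rho,4)$-packing with exactly $\rho n/3 + D(\rho,4)$ blocks in which the largest partial parallel class has size $\rho$.
   Context: For integers $v \ge k \ge 2$, a $(v,k)$-packing is a pair $(X,\mathcal{B})$ where $X$ is a set of $v$ points and $\mathcal{B}$ is a set of $k$-subsets of $X$ (blocks) such that every pair of distinct points lies in at most one block. For integers $m \ge 0$, $D(m,k)$ denotes the maximum number of $k$-subsets of an $m$-set such that every pair of points lies in at most one of them (so $D(m,k)=0$ if $m<k$). A partial parallel class (PPC) is a set of pairwise disjoint blocks; its size is the number of blocks in it. "The largest PPC has size $\rho$" means that the packing contains a PPC of size $\rho$ but no PPC of size $\rho+1$. -}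

module Defs where

open import Data.Bool.Properties as Bool using ()
open import Data.Fin.Base using (Fin)
import Data.Fin.Properties as Fin
open import Data.Fin.Subset as Subset using (Subset; inside; outside; ∣_∣; _∩_; Empty)
open import Data.Fin.Subset.Properties as Subset using ()
open import Data.List.Base using (List; []; _∷_; _++_; length; map; filter)
open import Data.List.Extrema.Nat using (argmax; argmax-all; f[xs]≤f[argmax])
open import Data.List.Membership.Propositional using (_∈_)
open import Data.List.Membership.Propositional.Properties using (∈-map⁺; ∈-map⁻; ∈-++⁺ˡ; ∈-++⁺ʳ; ∈-filter⁺; ∈-filter⁻)
open import Data.List.Membership.Propositional.Properties.WithK using (unique∧set⇒bag)
open import Data.List.Relation.Binary.BagAndSetEquality using (∼bag⇒↭)
open import Data.List.Relation.Binary.Permutation.Propositional using (_↭_; ↭⇒↭ₛ)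
open import Data.List.Relation.Binary.Permutation.Propositional.Properties using (All-resp-↭; filter-↭; ↭-length)
open import Data.List.Relation.Binary.Permutation.Setoid.Properties using (Unique-resp-↭)
open import Data.List.Relation.Binary.Subset.Propositional using (_⊆_)
open import Data.List.Relation.Unary.All as All using (All)
open import Data.List.Relation.Unary.All.Properties using (all-filter)
open import Data.List.Relation.Unary.AllPairs using (AllPairs; []; _∷_)
open import Data.List.Relation.Unary.Any using (here)
import Data.List.Relation.Unary.Unique.DecPropositional as DecUnique
open import Data.List.Relation.Unary.Unique.Propositional using (Unique)
open import Data.List.Relation.Unary.Unique.Propositional.Properties using (map⁺; ++⁺; filter⁺)
open import Data.Nat.Base using (ℕ; zero; suc; _≤_; z≤n)
open import Data.Nat.Properties as ℕ using ()
open import Data.Product.Base using (_×_; _,_; ∃-syntax; proj₂)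
import Data.Vec.Base as Vec
import Data.Vec.Properties as Vec
open import Function.Bundles using (mk⇔)
open import Relation.Binary.PropositionalEquality using (_≡_; _≢_; refl; sym; subst; setoid)
open import Relation.Nullary using (¬_; Dec; yes; no; ¬?; _×-dec_; _→-dec_)
open import Relation.Nullary.Decidable as Dec using ()

private
  variable
    v k m : ℕ

  _≟ˢ_ : (B C : Subset m) → Dec (B ≡ C)
  _≟ˢ_ = Vec.≡-dec Bool._≟_

-- Point sets are Fin v, and a set of blocks is a duplicate-free list of
-- subsets, so that its cardinality is its length.

pairDegree : List (Subset v) → Fin v → Fin v → ℕ
pairDegree 𝓑 x y = length (filter (λ B → (x Subset.∈? B) ×-dec (y Subset.∈? B)) 𝓑)

-- The bounds v ≥ k ≥ 2 are kept apart in IsPacking because D(m,k) also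
-- ranges over m < k.

record IsBlockSet (v k : ℕ) (𝓑 : List (Subset v)) : Set where
  field
    unique     : Unique 𝓑
    uniform    : All (λ B → ∣ B ∣ ≡ k) 𝓑
    atMostOnce : ∀ x y → x ≢ y → pairDegree 𝓑 x y ≤ 1

record IsPacking (v k : ℕ) (𝓑 : List (Subset v)) : Set where
  field
    2≤k        : 2 ≤ k
    k≤v        : k ≤ v
    isBlockSet : IsBlockSet v k 𝓑

record IsPPC (𝓑 P : List (Subset v)) : Set where
  field
    unique   : Unique P
    blocks   : P ⊆ 𝓑
    disjoint : AllPairs (λ B C → Empty (B ∩ C)) P

HasPPC : List (Subset v) → ℕ → Set
HasPPC 𝓑 s = ∃[ P ] IsPPC 𝓑 P × length P ≡ s

LargestPPCHasSize : List (Subset v) → ℕ → Set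
LargestPPCHasSize 𝓑 s = HasPPC 𝓑 s × ¬ HasPPC 𝓑 (suc s)

isBlockSet? : ∀ v k (𝓑 : List (Subset v)) → Dec (IsBlockSet v k 𝓑)
isBlockSet? v k 𝓑 = Dec.map′
  (λ (u , s , p) → record { unique = u ; uniform = s ; atMostOnce = p })
  (λ d → let open IsBlockSet d in unique , uniform , atMostOnce)
  (DecUnique.unique? _≟ˢ_ 𝓑
    ×-dec All.all? (λ B → ∣ B ∣ ℕ.≟ k) 𝓑
    ×-dec Fin.all? (λ x → Fin.all? (λ y →
      ¬? (x Fin.≟ y) →-dec (pairDegree 𝓑 x y ℕ.≤? 1))))

subsets : ∀ m → List (Subset m)
subsets zero    = Vec.[] ∷ []
subsets (suc m) = map (inside Vec.∷_) (subsets m) ++ map (outside Vec.∷_) (subsets m)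

sublists : {A : Set} → List A → List (List A)
sublists []       = [] ∷ []
sublists (x ∷ xs) = map (x ∷_) (sublists xs) ++ sublists xs

-- D-attained and D-maximal below show that this search over the families of
-- subsets of Fin m, each listed in the order of subsets m, yields the maximum.

D : ℕ → ℕ → ℕ
D m k = length (argmax length [] (filter (isBlockSet? m k) (sublists (subsets m))))

private
  ∈-subsets : (B : Subset m) → B ∈ subsets m
  ∈-subsets Vec.[]               = here refl
  ∈-subsets (inside  Vec.∷ B) = ∈-++⁺ˡ (∈-map⁺ _ (∈-subsets B))
  ∈-subsets (outside Vec.∷ B) = ∈-++⁺ʳ _ (∈-map⁺ _ (∈-subsets B))

  subsets-unique : ∀ m → Unique (subsets m)
  subsets-unique zero    = All.[] ∷ []
  subsets-unique (suc m) =
    ++⁺ (map⁺ Vec.∷-injectiveʳ (subsets-unique m))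
        (map⁺ Vec.∷-injectiveʳ (subsets-unique m))
        λ (p , q) → clash (∈-map⁻ _ p) (∈-map⁻ _ q)
    where
    clash : ∀ {B : Subset (suc m)} →
            ∃[ C ] C ∈ subsets m × B ≡ inside Vec.∷ C →
            ¬ (∃[ C ] C ∈ subsets m × B ≡ outside Vec.∷ C)
    clash (_ , _ , refl) (_ , _ , ())

  filter∈sublists : {A : Set} {P : A → Set} (P? : ∀ x → Dec (P x)) (xs : List A) →
                    filter P? xs ∈ sublists xs
  filter∈sublists P? []       = here refl
  filter∈sublists P? (x ∷ xs) with P? x
  ... | yes _ = ∈-++⁺ˡ (∈-map⁺ _ (filter∈sublists P? xs))
  ... | no  _ = ∈-++⁺ʳ _ (filter∈sublists P? xs)

  IsBlockSet-resp-↭ : ∀ {𝓑 𝓒} → 𝓑 ↭ 𝓒 → IsBlockSet v k 𝓑 → IsBlockSet v k 𝓒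
  IsBlockSet-resp-↭ 𝓑↭𝓒 d = record
    { unique     = Unique-resp-↭ (setoid _) (↭⇒↭ₛ 𝓑↭𝓒) unique
    ; uniform    = All-resp-↭ 𝓑↭𝓒 uniform
    ; atMostOnce = λ x y x≢y →
        subst (_≤ 1) (↭-length (filter-↭ _ 𝓑↭𝓒)) (atMostOnce x y x≢y)
    }
    where open IsBlockSet d

D-attained : ∀ m k → ∃[ 𝓑 ] IsBlockSet m k 𝓑 × length 𝓑 ≡ D m k
D-attained m k = _ ,
  argmax-all length
    (record { unique = [] ; uniform = All.[] ; atMostOnce = λ _ _ _ → z≤n })
    (all-filter (isBlockSet? m k) (sublists (subsets m))) ,
  refl

D-maximal : ∀ {𝓑} → IsBlockSet m k 𝓑 → length 𝓑 ≤ D m k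
D-maximal {m} {k} {𝓑} d = subst (_≤ D m k) (sym (↭-length 𝓑↭𝓒))
  (All.lookup
    (f[xs]≤f[argmax] {f = length} [] (filter (isBlockSet? m k) (sublists (subsets m))))
    (∈-filter⁺ (isBlockSet? m k)
      (filter∈sublists _∈𝓑? (subsets m)) (IsBlockSet-resp-↭ 𝓑↭𝓒 d)))
  where
  open import Data.List.Membership.DecPropositional (_≟ˢ_ {m}) using (_∈?_)

  _∈𝓑? : ∀ B → Dec (B ∈ 𝓑)
  B ∈𝓑? = B ∈? 𝓑

  𝓒 : List (Subset m)
  𝓒 = filter _∈𝓑? (subsets m)

  𝓑↭𝓒 : 𝓑 ↭ 𝓒
  𝓑↭𝓒 = ∼bag⇒↭ (unique∧set⇒bag (IsBlockSet.unique d) (filter⁺ _∈𝓑? (subsets-unique m))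
    (mk⇔ (λ p → ∈-filter⁺ _∈𝓑? (∈-subsets _) p)
         (λ p → proj₂ (∈-filter⁻ _∈𝓑? {xs = subsets m} p))))

{-# OPTIONS --safe #-}
module Submission where

-- Write n = 3m with m odd.  In a transversal design with four groups of size m,
-- the points of one group index m parallel classes of triples on the other
-- three.  Keep ρ of these classes, complete the triples of each by a new point,
-- and put an optimal packing on the ρ new points.  Every block contains a new
-- point, so no PPC has more than ρ blocks; if the design has a parallel class,
-- its blocks through the ρ new points form a PPC of size ρ.
--
-- Such a design with a parallel class is given by the four-term arithmetic
-- progressions of ℤ/m when m is coprime to 6.  When m ≡ 3 (mod 6), write
-- m = 4q + w with q ≥ w both coprime to 6, delete all but w points of one group
-- of a transversal design with five groups of size q, and fill in designs of
-- orders q, w, 4 and 5 on the groups and blocks.  Only m = 9, 15, 27, 39 escape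
-- this, besides the excluded m = 3.

open import Defs
open import Data.Empty using (⊥-elim)
open import Data.Fin.Base as Fin
  using (Fin; zero; suc; toℕ; fromℕ<; combine; remQuot; splitAt; _↑ʳ_; inject≤)
open import Data.Fin.Patterns
import Data.Fin.Properties as Fin
open import Data.Fin.Subset as Subset using (Subset; inside; outside; ∣_∣; _∩_; Empty; ⁅_⁆; ⊥)
  renaming (_∈_ to _∈ₛ_)
import Data.Fin.Subset.Properties as Subset
open import Data.List.Base as List
  using (List; []; _∷_; _++_; length; map; allFin; cartesianProduct)
import Data.List.Properties as List
open import Data.List.Membership.Propositional using (_∈_; _∉_)
open import Data.List.Membership.Propositional.Properties
open import Data.List.Relation.Unary.All as All using (All; []; _∷_)
import Data.List.Relation.Unary.All.Properties as All
open import Data.List.Relation.Unary.AllPairs as AllPairs using (AllPairs; []; _∷_)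
import Data.List.Relation.Unary.AllPairs.Properties as AllPairs
open import Data.List.Relation.Unary.Any using (here; there)
open import Data.List.Relation.Unary.Unique.Propositional using (Unique)
import Data.List.Relation.Unary.Unique.Propositional.Properties as Unique
open import Data.Nat.Base as ℕ
  using (ℕ; zero; suc; _+_; _*_; _∸_; _/_; _%_; _≤_; _<_; NonZero; z≤n; s≤s)
open import Data.Nat.DivMod
open import Data.Nat.Properties as ℕ using (+-comm; +-assoc)
open import Data.Nat.Tactic.RingSolver using (solve-∀)
open import Data.Product.Base using (_×_; _,_; ∃-syntax; proj₁; proj₂)
import Data.Product.Properties as Product
open import Data.Sum.Base as Sum using (_⊎_; inj₁; inj₂; [_,_]′)
open import Data.Sum.Function.Propositional using (_⊎-↔_)
import Data.Sum.Properties as Sum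
open import Data.Vec.Base as Vec using (Vec; []; _∷_; lookup)
import Data.Vec.Properties as Vec
open import Function.Base using (_∘_; id)
open import Function.Bundles using (_↔_; Inverse; mk↔ₛ′)
open import Function.Construct.Composition using (_↔-∘_)
open import Function.Construct.Identity using (↔-id)
open import Function.Construct.Symmetry using (↔-sym)
open import Relation.Binary.Definitions using (DecidableEquality; tri<; tri≈; tri>)
open import Relation.Binary.PropositionalEquality
open import Relation.Nullary
open import Relation.Nullary.Decidable using (True; toWitness)
open import Relation.Unary using (Decidable)

-- Idempotent transversal designs.

-- A transversal design on four copies of A.  Its blocks, one for each pair x y,
-- meet copy i in block x y i, and the constant blocks form a parallel class.
record IdempotentTD (A : Set) : Set where
  field
    block : A → A → Fin 4 → A
    block-zero  : ∀ x y → block x y 0F ≡ x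
    idempotent  : ∀ x i → block x x i ≡ x
    determined  : ∀ {x y x′ y′} i j → i ≢ j →
                  block x y i ≡ block x′ y′ i → block x y j ≡ block x′ y′ j →
                  x ≡ x′ × y ≡ y′

  -- If `a` is the common entry, the block agrees with the constant block of `a` in two copies, and
  -- two copies determine a block.
  block-constant : ∀ {x y} i j → i ≢ j → block x y i ≡ block x y j →
                   x ≡ block x y i × y ≡ block x y i
  block-constant i j i≢j eq = determined i j i≢j
    (sym (idempotent _ i)) (trans (sym eq) (sym (idempotent _ j)))

transport : ∀ {A B} → A ↔ B → IdempotentTD A → IdempotentTD B
transport A↔B td = record
  { block      = λ x y i → to (block (from x) (from y) i)
  ; block-zero = λ x y → trans (cong to (block-zero _ _)) (strictlyInverseˡ x)
  ; idempotent = λ x i → trans (cong to (idempotent _ i)) (strictlyInverseˡ x)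
  ; determined = λ i j i≢j p q →
      let (r , s) = determined i j i≢j (to-inj p) (to-inj q) in from-inj r , from-inj s
  }
  where
  open IdempotentTD td
  open Inverse A↔B
  to-inj : ∀ {x y} → to x ≡ to y → x ≡ y
  to-inj p = trans (sym (strictlyInverseʳ _)) (trans (cong from p) (strictlyInverseʳ _))
  from-inj : ∀ {x y} → from x ≡ from y → x ≡ y
  from-inj p = trans (sym (strictlyInverseˡ _)) (trans (cong to p) (strictlyInverseˡ _))

-- Residues modulo `m` and cyclic difference matrices.

module Modular (m : ℕ) .{{_ : NonZero m}} where

  infix 4 _≈_

  -- Calculations use natural representatives, so that `solve-∀` over ℕ does the rearranging and
  -- congruences compose by `trans`.
  _≈_ : ℕ → ℕ → Set
  a ≈ b = a % m ≡ b % m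

  residue : ℕ → Fin m
  residue a = a mod m

  ≡⇒≈ : ∀ {a b} → a ≡ b → a ≈ b
  ≡⇒≈ = cong (_% m)

  +-cong : ∀ {a b c d} → a ≈ b → c ≈ d → a + c ≈ b + d
  +-cong {a} {b} {c} {d} p q = trans (%-distribˡ-+ a c m)
    (trans (≡⇒≈ (cong₂ _+_ p q)) (sym (%-distribˡ-+ b d m)))

  *-congˡ : ∀ k {a b} → a ≈ b → k * a ≈ k * b
  *-congˡ k {a} {b} p = trans (%-distribˡ-* k a m)
    (trans (cong (λ z → (k % m * z) % m) p) (sym (%-distribˡ-* k b m)))

  -- At multiples of `m` the value is `m` rather than 0, another representative of the same class.
  neg : ℕ → ℕ
  neg a = m ∸ a % m

  +-neg : ∀ a → a + neg a ≈ 0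
  +-neg a = trans (+-cong (sym (m%n%n≡m%n a m)) refl)
    (trans (≡⇒≈ (ℕ.m+[n∸m]≡n (ℕ.<⇒≤ (m%n<n a m)))) (trans (n%n≡0 m) (sym (m*n%n≡0 0 m))))

  +-cancelˡ : ∀ c {a b} → c + a ≈ c + b → a ≈ b
  +-cancelˡ c {a} {b} p = trans (sym (drop a)) (trans (+-cong (refl {x = neg c % m}) p) (drop b))
    where
    drop : ∀ x → neg c + (c + x) ≈ x
    drop x = trans (≡⇒≈ (trans (sym (+-assoc (neg c) c x)) (cong (_+ x) (+-comm (neg c) c))))
      (+-cong (+-neg c) refl)

  residue-cong : ∀ {a b} → a ≈ b → residue a ≡ residue b
  residue-cong p = Fin.fromℕ<-cong _ _ p _ _

  toℕ-residue : ∀ a → toℕ (residue a) ≈ a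
  toℕ-residue a = trans (≡⇒≈ (Fin.toℕ-fromℕ< _)) (m%n%n≡m%n a m)

  residue-injective : ∀ {a b} → residue a ≡ residue b → a ≈ b
  residue-injective {a} {b} p =
    trans (sym (toℕ-residue a)) (trans (≡⇒≈ (cong toℕ p)) (toℕ-residue b))

  toℕ-injective-≈ : ∀ {x y : Fin m} → toℕ x ≈ toℕ y → x ≡ y
  toℕ-injective-≈ {x} {y} p = Fin.toℕ-injective
    (trans (sym (m<n⇒m%n≡m (Fin.toℕ<n x))) (trans p (m<n⇒m%n≡m (Fin.toℕ<n y))))

  residue-toℕ : ∀ x → residue (toℕ x) ≡ x
  residue-toℕ x = toℕ-injective-≈ (toℕ-residue (toℕ x))

  -- A (4,m;1)-difference matrix over ℤ/m, normalised to vanish in its first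
  -- row and in column 0; the difference condition is stated without
  -- subtraction.
  record DifferenceMatrix : Set where
    field
      entry       : Fin 4 → Fin m → ℕ
      zero-row    : ∀ d → entry 0F d ≡ 0
      zero-column : ∀ i → entry i (residue 0) ≡ 0
      differences : ∀ i j d e → i ≢ j →
                    entry i d + entry j e ≈ entry i e + entry j d → d ≡ e

  -- The blocks are the translates of the columns: `block x y` is column `y ⊖ x` shifted by `x`. The
  -- zero row puts `x` in copy 0, and column 0 yields the constant blocks.
  develop : DifferenceMatrix → IdempotentTD (Fin m)
  develop dm = record
    { block      = λ x y i → residue (toℕ x + entry i (y ⊖ x))
    ; block-zero = λ x y → trans
        (residue-cong (≡⇒≈ (trans (cong (toℕ x +_) (zero-row _)) (ℕ.+-identityʳ _))))
        (residue-toℕ x)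
    ; idempotent = λ x i → trans
        (residue-cong (≡⇒≈ (trans
          (cong (toℕ x +_) (trans (cong (entry i) (residue-cong (+-neg (toℕ x)))) (zero-column i)))
          (ℕ.+-identityʳ _))))
        (residue-toℕ x)
    ; determined = λ {x} {y} {x′} {y′} i j i≢j p q →
        determined′ x y x′ y′ i j i≢j (residue-injective p) (residue-injective q)
    }
    where
    open DifferenceMatrix dm

    _⊖_ : Fin m → Fin m → Fin m
    y ⊖ x = residue (toℕ y + neg (toℕ x))

    determined′ : ∀ x y x′ y′ i j → i ≢ j →
      toℕ x + entry i (y ⊖ x) ≈ toℕ x′ + entry i (y′ ⊖ x′) →
      toℕ x + entry j (y ⊖ x) ≈ toℕ x′ + entry j (y′ ⊖ x′) →
      x ≡ x′ × y ≡ y′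
    determined′ x y x′ y′ i j i≢j p q = x≡x′ , y≡y′
      where
      d e : Fin m
      d = y ⊖ x
      e = y′ ⊖ x′

      cross : ∀ a b r s → (a + b) + (r + s) ≡ (a + r) + (b + s)
      cross = solve-∀

      cross′ : ∀ a b r s → (a + r) + (b + s) ≡ (b + a) + (r + s)
      cross′ = solve-∀

      -- Adding the first congruence to the reverse of the second lets both translations cancel,
      -- which leaves the difference condition for columns `d` and `e`.
      d≡e : d ≡ e
      d≡e = differences i j d e i≢j (+-cancelˡ (toℕ x + toℕ x′)
        (trans (≡⇒≈ (cross (toℕ x) (toℕ x′) (entry i d) (entry j e)))
          (trans (+-cong p (sym q))
            (≡⇒≈ (cross′ (toℕ x′) (toℕ x) (entry i e) (entry j d))))))

      x≡x′ : x ≡ x′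
      x≡x′ = toℕ-injective-≈ (+-cancelˡ (entry i e)
        (trans (≡⇒≈ (+-comm (entry i e) (toℕ x)))
          (trans (≡⇒≈ (cong (λ z → toℕ x + entry i z) (sym d≡e)))
            (trans p (≡⇒≈ (+-comm (toℕ x′) (entry i e)))))))

      y≡y′ : y ≡ y′
      y≡y′ = toℕ-injective-≈ (+-cancelˡ (neg (toℕ x))
        (trans (≡⇒≈ (+-comm (neg (toℕ x)) (toℕ y)))
          (trans (residue-injective d≡e)
            (≡⇒≈ (trans (cong (λ z → toℕ y′ + neg (toℕ z)) (sym x≡x′))
              (+-comm (toℕ y′) (neg (toℕ x))))))))

  Unit : ℕ → Set
  Unit k = ∃[ u ] k * u ≈ 1

  unit-cancel : ∀ k → Unit k → ∀ {d e} → k * d ≈ k * e → d ≈ e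
  unit-cancel k (u , ku≈1) {d} {e} p = trans (sym (undo d)) (trans (*-congˡ u p) (undo e))
    where
    rearrange : ∀ k u x → u * (k * x) ≡ x * (k * u)
    rearrange = solve-∀
    undo : ∀ x → u * (k * x) ≈ x
    undo x = trans (≡⇒≈ (rearrange k u x)) (trans (*-congˡ x ku≈1) (≡⇒≈ (ℕ.*-identityʳ x)))

  -- The differences of distinct indices in `Fin 4` are 1, 2 and 3 up to sign; their invertibility
  -- means that `m` is coprime to 6.
  SmallUnits : Set
  SmallUnits = ∀ k → 1 ≤ k → k ≤ 3 → Unit k

  gap-unit : SmallUnits → ∀ (i j : Fin 4) → toℕ i < toℕ j → ∃[ k ] Unit k × toℕ j ≡ toℕ i + k
  gap-unit units i j i<j = toℕ j ∸ toℕ i ,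
    units _ (ℕ.m<n⇒0<n∸m i<j) (ℕ.≤-trans (ℕ.m∸n≤m (toℕ j) (toℕ i)) (Fin.toℕ≤pred[n] j)) ,
    sym (ℕ.m+[n∸m]≡n (ℕ.<⇒≤ i<j))

  -- The blocks developed from this matrix are the four-term arithmetic
  -- progressions of ℤ/m.
  progressions : SmallUnits → DifferenceMatrix
  progressions units = record
    { entry       = λ i d → toℕ i * toℕ d
    ; zero-row    = λ d → refl
    ; zero-column = λ i → trans
        (cong (toℕ i *_) (trans (Fin.toℕ-fromℕ< _) (m*n%n≡0 0 m))) (ℕ.*-zeroʳ (toℕ i))
    ; differences = differences
    }
    where
    expand : ∀ i k d e → i * d + (i + k) * e ≡ (i * d + i * e) + k * e
    expand = solve-∀
    expand′ : ∀ i k d e → i * e + (i + k) * d ≡ (i * d + i * e) + k * d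
    expand′ = solve-∀

    -- Writing `j = i + k`, both sides share `i * d + i * e`; what remains is `k * e ≈ k * d` with
    -- `k` a unit.
    ordered : ∀ (i j : Fin 4) (d e : Fin m) → toℕ i < toℕ j →
              toℕ i * toℕ d + toℕ j * toℕ e ≈ toℕ i * toℕ e + toℕ j * toℕ d → d ≡ e
    ordered i j d e i<j p with gap-unit units i j i<j
    ... | k , unit , eq rewrite eq = sym (toℕ-injective-≈ (unit-cancel k unit
      (+-cancelˡ (toℕ i * toℕ d + toℕ i * toℕ e)
        (trans (≡⇒≈ (sym (expand (toℕ i) k (toℕ d) (toℕ e))))
          (trans p (≡⇒≈ (expand′ (toℕ i) k (toℕ d) (toℕ e))))))))

    differences : ∀ (i j : Fin 4) (d e : Fin m) → i ≢ j →
                  toℕ i * toℕ d + toℕ j * toℕ e ≈ toℕ i * toℕ e + toℕ j * toℕ d → d ≡ e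
    differences i j d e i≢j p with Fin.<-cmp i j
    ... | tri< i<j _ _ = ordered i j d e i<j p
    ... | tri≈ _ i≡j _ = ⊥-elim (i≢j i≡j)
    ... | tri> _ _ j<i = ordered j i d e j<i
      (trans (≡⇒≈ (+-comm (toℕ j * toℕ d) _)) (trans (sym p) (≡⇒≈ (+-comm (toℕ i * toℕ d) _))))

-- Small orders, verified by evaluation.

module _ {m : ℕ} .{{_ : NonZero m}} (φ ψ : Vec ℕ m) where
  open Modular m

  -- Columns are labelled by their entry in row 1. The difference condition then says that `φ`, `ψ`,
  -- `φ - id`, `ψ - id` and `ψ - φ` are permutations modulo `m`: a pair of orthogonal orthomorphisms
  -- of ℤ/m.
  rows : Fin 4 → Fin m → ℕ
  rows 0F d = 0
  rows 1F d = toℕ d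
  rows 2F d = lookup φ d
  rows 3F d = lookup ψ d

  tabulated? : Dec ((∀ i → rows i (residue 0) ≡ 0) ×
    (∀ i j d e → i ≢ j → (rows i d + rows j e) % m ≡ (rows i e + rows j d) % m → d ≡ e))
  tabulated? = Fin.all? (λ i → rows i (residue 0) ℕ.≟ 0) ×-dec
    Fin.all? (λ i → Fin.all? λ j → Fin.all? λ d → Fin.all? λ e →
      ¬? (i Fin.≟ j) →-dec
      ((rows i d + rows j e) % m ℕ.≟ (rows i e + rows j d) % m) →-dec (d Fin.≟ e))

  -- The implicit argument is solved by running the decision procedure, so each table is verified
  -- during type checking.
  tabulated : {True tabulated?} → DifferenceMatrix
  tabulated {t} = record
    { entry       = rows
    ; zero-row    = λ d → refl
    ; zero-column = proj₁ (toWitness t)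
    ; differences = proj₂ (toWitness t)
    }

-- The three pairs of rows below were found by computer search, those of orders
-- 27 and 39 with a prescribed symmetry of order 3.
td15 : IdempotentTD (Fin 15)
td15 = develop (tabulated φ ψ)
  where
  open Modular 15
  φ ψ : Vec ℕ 15
  φ = 0 ∷ 3 ∷ 11 ∷ 8 ∷ 12 ∷ 6 ∷ 2 ∷ 10 ∷ 14 ∷ 4 ∷ 7 ∷ 9 ∷ 1 ∷ 5 ∷ 13 ∷ []
  ψ = 0 ∷ 7 ∷ 13 ∷ 1 ∷ 6 ∷ 12 ∷ 5 ∷ 8 ∷ 11 ∷ 3 ∷ 14 ∷ 4 ∷ 2 ∷ 10 ∷ 9 ∷ []

td27 : IdempotentTD (Fin 27)
td27 = develop (tabulated φ ψ)
  where
  open Modular 27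
  φ ψ : Vec ℕ 27
  φ = 0 ∷ 12 ∷ 17 ∷ 11 ∷ 20 ∷ 1 ∷ 18 ∷ 24 ∷ 7 ∷ 22 ∷ 14 ∷ 25 ∷ 6 ∷ 10 ∷ 5 ∷ 13 ∷ 8 ∷ 23 ∷
      19 ∷ 21 ∷ 2 ∷ 16 ∷ 15 ∷ 26 ∷ 4 ∷ 3 ∷ 9 ∷ []
  ψ = 0 ∷ 4 ∷ 1 ∷ 20 ∷ 14 ∷ 3 ∷ 7 ∷ 25 ∷ 19 ∷ 18 ∷ 2 ∷ 15 ∷ 24 ∷ 8 ∷ 11 ∷ 21 ∷ 5 ∷ 22 ∷
      12 ∷ 26 ∷ 16 ∷ 23 ∷ 10 ∷ 9 ∷ 17 ∷ 6 ∷ 13 ∷ []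

td39 : IdempotentTD (Fin 39)
td39 = develop (tabulated φ ψ)
  where
  open Modular 39
  φ ψ : Vec ℕ 39
  φ = 0 ∷ 22 ∷ 36 ∷ 10 ∷ 37 ∷ 8 ∷ 35 ∷ 27 ∷ 21 ∷ 32 ∷ 6 ∷ 13 ∷ 4 ∷ 38 ∷ 33 ∷ 23 ∷ 25 ∷ 5 ∷
      15 ∷ 17 ∷ 24 ∷ 26 ∷ 28 ∷ 2 ∷ 34 ∷ 1 ∷ 9 ∷ 18 ∷ 29 ∷ 14 ∷ 19 ∷ 3 ∷ 31 ∷ 20 ∷ 7 ∷ 12 ∷
      11 ∷ 30 ∷ 16 ∷ []
  ψ = 0 ∷ 31 ∷ 37 ∷ 23 ∷ 1 ∷ 19 ∷ 33 ∷ 20 ∷ 27 ∷ 24 ∷ 14 ∷ 18 ∷ 38 ∷ 11 ∷ 22 ∷ 4 ∷ 21 ∷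
      7 ∷ 30 ∷ 5 ∷ 3 ∷ 13 ∷ 25 ∷ 16 ∷ 2 ∷ 34 ∷ 28 ∷ 9 ∷ 12 ∷ 35 ∷ 29 ∷ 26 ∷ 17 ∷ 10 ∷ 6 ∷
      36 ∷ 15 ∷ 8 ∷ 32 ∷ []

module _ {m : ℕ} (f : Fin m → Fin m → Fin 4 → Fin m) where

  exhaustive? : Dec ((∀ x y → f x y 0F ≡ x) × (∀ x i → f x x i ≡ x) ×
    (∀ x y x′ y′ i j → i ≢ j → f x y i ≡ f x′ y′ i → f x y j ≡ f x′ y′ j → x ≡ x′ × y ≡ y′))
  exhaustive? =
    (Fin.all? λ x → Fin.all? λ y → f x y 0F Fin.≟ x) ×-dec
    (Fin.all? λ x → Fin.all? λ i → f x x i Fin.≟ x) ×-dec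
    (Fin.all? λ x → Fin.all? λ y → Fin.all? λ x′ → Fin.all? λ y′ → Fin.all? λ i → Fin.all? λ j →
      ¬? (i Fin.≟ j) →-dec (f x y i Fin.≟ f x′ y′ i) →-dec (f x y j Fin.≟ f x′ y′ j) →-dec
      ((x Fin.≟ x′) ×-dec (y Fin.≟ y′)))

  exhaustive : {True exhaustive?} → IdempotentTD (Fin m)
  exhaustive {t} = let (p , q , r) = toWitness t in record
    { block = f ; block-zero = p ; idempotent = q
    ; determined = λ {x} {y} {x′} {y′} i j → r x y x′ y′ i j }

-- The blocks are the points x + c (y - x) of the affine line over 𝔽₄ or 𝔽₉ at
-- c = 0, 1, ω, ω² for a generator ω of the multiplicative group.  The pair (a , b)
-- encodes a + bω with ω² = ω + 1 in 𝔽₄, and a + bi with i² = -1 and ω = 1 + i in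
-- 𝔽₉; in both cases u and v are the digits of y - x.
td4 : IdempotentTD (Fin 4)
td4 = exhaustive quadruple
  where
  quadruple : Fin 4 → Fin 4 → Fin 4 → Fin 4
  quadruple x y i =
    let (a , b) = remQuot {2} 2 x
        (c , d) = remQuot {2} 2 y
        u       = toℕ c + toℕ a
        v       = toℕ d + toℕ b
    in at i (toℕ a) (toℕ b) u v
    where
    at : Fin 4 → ℕ → ℕ → ℕ → ℕ → Fin 4
    at 0F a b u v = x
    at 1F a b u v = y
    at 2F a b u v = combine ((a + v) mod 2) ((b + u + v) mod 2)
    at 3F a b u v = combine ((a + u + v) mod 2) ((b + u) mod 2)

td9 : IdempotentTD (Fin 9)
td9 = exhaustive quadruple
  where
  quadruple : Fin 9 → Fin 9 → Fin 4 → Fin 9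
  quadruple x y i =
    let (a , b) = remQuot {3} 3 x
        (c , d) = remQuot {3} 3 y
        -- Modulo 3 the factor 2 stands for -1, here and below in the products of u + vi with ω = 1
        -- + i and ω² = -i.
        u       = toℕ c + 2 * toℕ a
        v       = toℕ d + 2 * toℕ b
    in at i (toℕ a) (toℕ b) u v
    where
    at : Fin 4 → ℕ → ℕ → ℕ → ℕ → Fin 9
    at 0F a b u v = x
    at 1F a b u v = y
    at 2F a b u v = combine ((a + u + 2 * v) mod 3) ((b + u + v) mod 3)
    at 3F a b u v = combine ((a + v) mod 3) ((b + 2 * u) mod 3)


-- Filling the lines of a pairwise balanced design.

-- A pairwise balanced design.  Join is also required of equal points, so that
-- fill needs no case distinction.
record LinearSpace (A : Set) : Set₁ where
  field
    Line            : Set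
    Position        : Line → Set
    point           : ∀ ℓ → Position ℓ → A
    point-injective : ∀ ℓ {h k} → point ℓ h ≡ point ℓ k → h ≡ k

  Join : A → A → Set
  Join x y = ∃[ ℓ ] ∃[ h ] ∃[ k ] point ℓ h ≡ x × point ℓ k ≡ y

  field
    join        : ∀ x y → Join x y
    line-unique : ∀ {ℓ ℓ′ h k h′ k′} → h ≢ k →
                  point ℓ h ≡ point ℓ′ h′ → point ℓ k ≡ point ℓ′ k′ → ℓ ≡ ℓ′

-- Each block is taken inside the line joining its two indices. For equal indices that line is an
-- arbitrary one through the point, and idempotence makes the result independent of it.
fill : ∀ {A} → DecidableEquality A → (S : LinearSpace A) →
       (∀ ℓ → IdempotentTD (LinearSpace.Position S ℓ)) → IdempotentTD A
fill {A} _≟_ S td = record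
  { block      = λ x y → filled (join x y)
  ; block-zero = λ x y → filled-zero (join x y)
  ; idempotent = λ x → filled-idempotent (join x x)
  ; determined = λ {x} {y} {x′} {y′} → filled-determined (join x y) (join x′ y′)
  }
  where
  open LinearSpace S
  open module TD ℓ = IdempotentTD (td ℓ)

  filled : ∀ {x y} → Join x y → Fin 4 → A
  filled (ℓ , h , k , _) i = point ℓ (block ℓ h k i)

  filled-zero : ∀ {x y} (J : Join x y) → filled J 0F ≡ x
  filled-zero (ℓ , h , k , p , _) = trans (cong (point ℓ) (block-zero ℓ h k)) p

  filled-idempotent : ∀ {x} (J : Join x x) i → filled J i ≡ x
  filled-idempotent (ℓ , h , k , p , q) i
    with refl ← point-injective ℓ {h} {k} (trans p (sym q)) =
    trans (cong (point ℓ) (idempotent ℓ h i)) p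

  -- If the values at `i` and `j` differ, they are two points common to both lines, so the lines
  -- coincide and the design on that line decides. If they agree, both blocks are constant with the
  -- same value.
  filled-determined : ∀ {x y x′ y′} (J : Join x y) (J′ : Join x′ y′) i j → i ≢ j →
    filled J i ≡ filled J′ i → filled J j ≡ filled J′ j → x ≡ x′ × y ≡ y′
  filled-determined (ℓ , h , k , refl , refl) (ℓ′ , h′ , k′ , refl , refl) i j i≢j p q
    with point ℓ (block ℓ h k i) ≟ point ℓ (block ℓ h k j)
  ... | yes eq =
    let (r , s)   = block-constant ℓ i j i≢j (point-injective ℓ eq)
        (r′ , s′) = block-constant ℓ′ i j i≢j
                      (point-injective ℓ′ (trans (sym p) (trans eq q)))
    in trans (cong (point ℓ) r) (trans p (sym (cong (point ℓ′) r′))) ,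
       trans (cong (point ℓ) s) (trans p (sym (cong (point ℓ′) s′)))
  ... | no neq with refl ← line-unique (neq ∘ cong (point ℓ)) p q =
    let (r , s) = determined ℓ i j i≢j (point-injective ℓ p) (point-injective ℓ q)
    in cong (point ℓ) r , cong (point ℓ) s

-- Truncated transversal designs with five groups.

module _ (q w : ℕ) .{{_ : NonZero q}} (units : Modular.SmallUnits q) (w≤q : w ≤ q) where
  open Modular q

  Point : Set
  Point = (Fin 4 × Fin q) ⊎ Fin w

  -- `cross s t` is the line of intercept `s` and slope `t`: it meets full group `i` at `s + i * t`
  -- and the fifth group at `t`. Truncation keeps the points of the fifth group below `w`.
  data TruncatedLine : Set where
    group : Fin 4 → TruncatedLine
    short : TruncatedLine
    cross : Fin q → Fin q → TruncatedLine

  -- The type `toℕ t < w` has at most one element, so it adds one position exactly to the lines that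
  -- reach a surviving point of the fifth group.
  TruncatedPosition : TruncatedLine → Set
  TruncatedPosition (group i)   = Fin q
  TruncatedPosition short       = Fin w
  TruncatedPosition (cross s t) = Fin 4 ⊎ toℕ t < w

  crossing : Fin q → Fin q → Fin 4 → Fin q
  crossing s t i = residue (toℕ s + toℕ i * toℕ t)

  truncatedPoint : ∀ ℓ → TruncatedPosition ℓ → Point
  truncatedPoint (group i)   a          = inj₁ (i , a)
  truncatedPoint short       a          = inj₂ a
  truncatedPoint (cross s t) (inj₁ i)   = inj₁ (i , crossing s t i)
  truncatedPoint (cross s t) (inj₂ t<w) = inj₂ (fromℕ< t<w)

  truncatedPoint-injective : ∀ ℓ {h k} → truncatedPoint ℓ h ≡ truncatedPoint ℓ k → h ≡ k
  truncatedPoint-injective (group i)   refl = refl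
  truncatedPoint-injective short       refl = refl
  truncatedPoint-injective (cross s t) {inj₁ i} {inj₁ j} p =
    cong (inj₁ ∘ proj₁) (Sum.inj₁-injective p)
  truncatedPoint-injective (cross s t) {inj₂ _} {inj₂ _} p = cong inj₂ (ℕ.<-irrelevant _ _)

  crossing-slope : ∀ {s t s′ t′} i → t ≡ t′ → crossing s t i ≡ crossing s′ t′ i → s ≡ s′
  crossing-slope {s} {t} {s′} i refl p = toℕ-injective-≈ (+-cancelˡ (toℕ i * toℕ t)
    (trans (≡⇒≈ (+-comm (toℕ i * toℕ t) (toℕ s)))
      (trans (residue-injective p) (≡⇒≈ (+-comm (toℕ s′) (toℕ i * toℕ t))))))

  -- With `j = i + k`, the values at `i` and `j` differ by `k * t`, and `k` is a unit.
  crossing-< : ∀ {s t s′ t′} i j → toℕ i < toℕ j →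
               crossing s t i ≡ crossing s′ t′ i → crossing s t j ≡ crossing s′ t′ j → t ≡ t′
  crossing-< {s} {t} {s′} {t′} i j i<j p r with gap-unit units i j i<j
  ... | k , unit , eq rewrite eq = toℕ-injective-≈ (unit-cancel k unit
    (+-cancelˡ (toℕ s + toℕ i * toℕ t)
      (trans (≡⇒≈ (expand (toℕ s) (toℕ i) k (toℕ t)))
        (trans (residue-injective r)
          (trans (≡⇒≈ (sym (expand (toℕ s′) (toℕ i) k (toℕ t′))))
            (+-cong (sym (residue-injective p)) refl))))))
    where
    expand : ∀ s i k t → (s + i * t) + k * t ≡ s + (i + k) * t
    expand = solve-∀

  crossing-injective : ∀ {s t s′ t′} i j → i ≢ j →
    crossing s t i ≡ crossing s′ t′ i → crossing s t j ≡ crossing s′ t′ j → s ≡ s′ × t ≡ t′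
  crossing-injective {s} {t} {s′} {t′} i j i≢j p r = crossing-slope i t≡t′ p , t≡t′
    where
    t≡t′ : t ≡ t′
    t≡t′ with Fin.<-cmp i j
    ... | tri< i<j _ _ = crossing-< {s} {t} {s′} {t′} i j i<j p r
    ... | tri≈ _ i≡j _ = ⊥-elim (i≢j i≡j)
    ... | tri> _ _ j<i = crossing-< {s} {t} {s′} {t′} j i j<i r p

  crossing-through : ∀ i t a → ∃[ s ] crossing s t i ≡ a
  crossing-through i t a = residue (toℕ a + neg (toℕ i * toℕ t)) ,
    trans (residue-cong (trans (+-cong (toℕ-residue (toℕ a + neg (toℕ i * toℕ t))) refl)
      (trans (≡⇒≈ (+-assoc (toℕ a) _ _))
        (trans (+-cong (refl {x = toℕ a % q})
          (trans (≡⇒≈ (+-comm (neg (toℕ i * toℕ t)) _)) (+-neg (toℕ i * toℕ t))))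
          (≡⇒≈ (ℕ.+-identityʳ (toℕ a)))))))
      (residue-toℕ a)

  crossing-solve : ∀ i j a b → toℕ i < toℕ j →
                   ∃[ s ] ∃[ t ] crossing s t i ≡ a × crossing s t j ≡ b
  crossing-solve i j a b i<j with gap-unit units i j i<j
  ... | k , (u , ku≈1) , eq = s , t , p , trans (residue-cong at-j) (residue-toℕ b)
    where
    δ : ℕ
    δ = toℕ b + neg (toℕ a)
    t s : Fin q
    -- The slope is (b - a)/(j - i), with `u` the inverse of `k = j - i`.
    t = residue (u * δ)
    s = proj₁ (crossing-through i t a)
    p : crossing s t i ≡ a
    p = proj₂ (crossing-through i t a)
    expand : ∀ s i k t → s + (i + k) * t ≡ (s + i * t) + k * t
    expand = solve-∀
    rearrange : ∀ k u x → k * (u * x) ≡ x * (k * u)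
    rearrange = solve-∀
    swap : ∀ a b c → a + (b + c) ≡ b + (a + c)
    swap = solve-∀
    kt≈δ : k * toℕ t ≈ δ
    kt≈δ = trans (*-congˡ k (toℕ-residue (u * δ))) (trans (≡⇒≈ (rearrange k u δ))
      (trans (*-congˡ δ ku≈1) (≡⇒≈ (ℕ.*-identityʳ δ))))
    at-j : toℕ s + toℕ j * toℕ t ≈ toℕ b
    at-j = trans (≡⇒≈ (trans (cong (λ z → toℕ s + z * toℕ t) eq)
                             (expand (toℕ s) (toℕ i) k (toℕ t))))
      (trans (+-cong (trans (sym (toℕ-residue _)) (≡⇒≈ (cong toℕ p))) kt≈δ)
        (trans (≡⇒≈ (swap (toℕ a) (toℕ b) (neg (toℕ a))))
          (trans (+-cong (refl {x = toℕ b % q}) (+-neg (toℕ a))) (≡⇒≈ (ℕ.+-identityʳ (toℕ b))))))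

  -- A point of the short group prescribes the slope, which leaves only the intercept to solve for.
  through-short : ∀ i a (b : Fin w) →
    ∃[ s ] ∃[ t ] ∃[ t<w ] crossing s t i ≡ a × fromℕ< {toℕ t} t<w ≡ b
  through-short i a b = proj₁ (crossing-through i t a) , t , t<w ,
    proj₂ (crossing-through i t a) , Fin.toℕ-injective (trans (Fin.toℕ-fromℕ< t<w) t≡b)
    where
    b<q : toℕ b < q
    b<q = ℕ.<-≤-trans (Fin.toℕ<n b) w≤q
    t : Fin q
    t = fromℕ< b<q
    t≡b : toℕ t ≡ toℕ b
    t≡b = Fin.toℕ-fromℕ< b<q
    t<w : toℕ t < w
    t<w = subst (_< w) (sym t≡b) (Fin.toℕ<n b)

  truncatedJoin : ∀ x y → ∃[ ℓ ] ∃[ h ] ∃[ k ] truncatedPoint ℓ h ≡ x × truncatedPoint ℓ k ≡ y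
  truncatedJoin (inj₁ (i , a)) (inj₁ (j , b)) with Fin.<-cmp i j
  ... | tri< i<j _ _ = let (s , t , p , r) = crossing-solve i j a b i<j in
    cross s t , inj₁ i , inj₁ j , cong (λ z → inj₁ (i , z)) p , cong (λ z → inj₁ (j , z)) r
  ... | tri≈ _ refl _ = group i , a , b , refl , refl
  ... | tri> _ _ j<i = let (s , t , p , r) = crossing-solve j i b a j<i in
    cross s t , inj₁ i , inj₁ j , cong (λ z → inj₁ (i , z)) r , cong (λ z → inj₁ (j , z)) p
  truncatedJoin (inj₁ (i , a)) (inj₂ b) = let (s , t , t<w , p , r) = through-short i a b in
    cross s t , inj₁ i , inj₂ t<w , cong (λ z → inj₁ (i , z)) p , cong inj₂ r
  truncatedJoin (inj₂ a) (inj₁ (j , b)) = let (s , t , t<w , p , r) = through-short j b a in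
    cross s t , inj₂ t<w , inj₁ j , cong inj₂ r , cong (λ z → inj₁ (j , z)) p
  truncatedJoin (inj₂ a) (inj₂ b) = short , a , b , refl , refl

  fromℕ<-slope : ∀ {t t′ : Fin q} (p : toℕ t < w) (p′ : toℕ t′ < w) →
                 fromℕ< p ≡ fromℕ< p′ → t ≡ t′
  fromℕ<-slope p p′ eq = Fin.toℕ-injective (Fin.fromℕ<-injective _ _ p p′ eq)

  -- A crossing line meets each group at most once, which excludes the mixed cases. Two crossing
  -- lines with two common points agree in slope and intercept; a common point in the short group
  -- gives the slope at once.
  truncatedLine-unique : ∀ ℓ ℓ′ h k h′ k′ → h ≢ k →
    truncatedPoint ℓ h ≡ truncatedPoint ℓ′ h′ → truncatedPoint ℓ k ≡ truncatedPoint ℓ′ k′ → ℓ ≡ ℓ′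
  truncatedLine-unique (group i) (group j) h k h′ k′ h≢k refl p = refl
  truncatedLine-unique (group i) (cross s t) h k (inj₁ .i) (inj₁ .i) h≢k refl refl =
    ⊥-elim (h≢k refl)
  truncatedLine-unique short short h k h′ k′ h≢k p r = refl
  truncatedLine-unique short (cross s t) h k (inj₂ a) (inj₂ b) h≢k refl refl =
    ⊥-elim (h≢k (cong (λ z → fromℕ< z) (ℕ.<-irrelevant a b)))
  truncatedLine-unique (cross s t) (group i) (inj₁ j) (inj₁ j′) h′ k′ h≢k refl refl =
    ⊥-elim (h≢k refl)
  truncatedLine-unique (cross s t) short (inj₂ a) (inj₂ b) h′ k′ h≢k p r =
    ⊥-elim (h≢k (cong inj₂ (ℕ.<-irrelevant a b)))
  truncatedLine-unique (cross s t) (cross s′ t′) (inj₁ i) (inj₁ j) (inj₁ i′) (inj₁ j′) h≢k p r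
    with refl , p′ ← Product.,-injective (Sum.inj₁-injective p)
       | refl , r′ ← Product.,-injective (Sum.inj₁-injective r)
    with refl , refl ← crossing-injective {s} {t} {s′} {t′} i j (h≢k ∘ cong inj₁) p′ r′ = refl
  truncatedLine-unique (cross s t) (cross s′ t′) (inj₁ i) (inj₂ b) (inj₁ i′) (inj₂ b′) h≢k p r
    with refl , p′ ← Product.,-injective (Sum.inj₁-injective p)
    with refl ← fromℕ<-slope {t} {t′} b b′ (Sum.inj₂-injective r)
    with refl ← crossing-slope {s} {t} {s′} i refl p′ = refl
  truncatedLine-unique (cross s t) (cross s′ t′) (inj₂ a) (inj₁ j) (inj₂ a′) (inj₁ j′) h≢k p r
    with refl , r′ ← Product.,-injective (Sum.inj₁-injective r)
    with refl ← fromℕ<-slope {t} {t′} a a′ (Sum.inj₂-injective p)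
    with refl ← crossing-slope {s} {t} {s′} j refl r′ = refl
  truncatedLine-unique (cross s t) (cross s′ t′) (inj₂ a) (inj₂ b) h′ k′ h≢k p r =
    ⊥-elim (h≢k (cong inj₂ (ℕ.<-irrelevant a b)))

  truncated : LinearSpace Point
  truncated = record
    { Line            = TruncatedLine
    ; Position        = TruncatedPosition
    ; point           = truncatedPoint
    ; point-injective = truncatedPoint-injective
    ; join            = truncatedJoin
    ; line-unique     = λ {ℓ} {ℓ′} → truncatedLine-unique ℓ ℓ′ _ _ _ _
    }

  -- A crossing line has five points if it meets the short group and four otherwise.
  truncated-td : IdempotentTD (Fin 5) → IdempotentTD (Fin w) → IdempotentTD (Fin (4 * q + w))
  truncated-td td5 tdw = transport points↔Fin
    (fill (Sum.≡-dec (Product.≡-dec Fin._≟_ Fin._≟_) Fin._≟_) truncated ingredient)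
    where
    points↔Fin : Point ↔ Fin (4 * q + w)
    points↔Fin = ↔-sym ((Fin.*↔× ⊎-↔ ↔-id (Fin w)) ↔-∘ Fin.+↔⊎)
    crossIngredient : ∀ t → Dec (toℕ t < w) → IdempotentTD (Fin 4 ⊎ toℕ t < w)
    crossIngredient t (yes t<w) = transport
      (mk↔ₛ′ (λ { 0F → inj₂ t<w ; (suc i) → inj₁ i })
             (λ { (inj₁ i) → suc i ; (inj₂ _) → 0F })
             (λ { (inj₁ i) → refl ; (inj₂ _) → cong inj₂ (ℕ.<-irrelevant _ _) })
             (λ { 0F → refl ; (suc i) → refl }))
      td5
    crossIngredient t (no t≮w) = transport
      (mk↔ₛ′ inj₁ (λ { (inj₁ i) → i ; (inj₂ t<w) → ⊥-elim (t≮w t<w) })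
             (λ { (inj₁ i) → refl ; (inj₂ t<w) → ⊥-elim (t≮w t<w) })
             (λ _ → refl))
      td4
    ingredient : ∀ ℓ → IdempotentTD (TruncatedPosition ℓ)
    ingredient (group i)   = develop (progressions units)
    ingredient short       = tdw
    ingredient (cross s t) = crossIngredient t (toℕ t ℕ.<? w)

-- Linearity of block sets, disjoint families and concatenated subsets.

private
  variable
    v m n k : ℕ

-- The count-free form of `atMostOnce`, equivalent to it for duplicate-free lists.
Linear : List (Subset v) → Set
Linear 𝓑 = ∀ {B C x y} → B ∈ 𝓑 → C ∈ 𝓑 → x ≢ y →
           x ∈ₛ B → y ∈ₛ B → x ∈ₛ C → y ∈ₛ C → B ≡ C

unique-constant-length : {A : Set} {xs : List A} → Unique xs →
                         (∀ {x y} → x ∈ xs → y ∈ xs → x ≡ y) → length xs ≤ 1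
unique-constant-length []                   _  = z≤n
unique-constant-length (_ ∷ [])             _  = s≤s z≤n
unique-constant-length ((x≢y ∷ _) ∷ (_ ∷ _)) eq = ⊥-elim (x≢y (eq (here refl) (there (here refl))))

constant-of-length : {A : Set} {xs : List A} → length xs ≤ 1 →
                     ∀ {x y} → x ∈ xs → y ∈ xs → x ≡ y
constant-of-length _        (here refl) (here refl) = refl
constant-of-length {xs = _ ∷ _ ∷ _} (s≤s ()) _ _

linear⇒atMostOnce : {𝓑 : List (Subset v)} → Unique 𝓑 → Linear 𝓑 →
                    ∀ x y → x ≢ y → pairDegree 𝓑 x y ≤ 1
linear⇒atMostOnce {𝓑 = 𝓑} unique linear x y x≢y =
  unique-constant-length (Unique.filter⁺ both? unique) λ B∈ C∈ →
    let (B∈𝓑 , x∈B , y∈B) = ∈-filter⁻ both? {xs = 𝓑} B∈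
        (C∈𝓑 , x∈C , y∈C) = ∈-filter⁻ both? {xs = 𝓑} C∈
    in linear B∈𝓑 C∈𝓑 x≢y x∈B y∈B x∈C y∈C
  where
  both? : Decidable (λ B → x ∈ₛ B × y ∈ₛ B)
  both? B = (x Subset.∈? B) ×-dec (y Subset.∈? B)

blockSet⇒linear : {𝓑 : List (Subset v)} → IsBlockSet v k 𝓑 → Linear 𝓑
blockSet⇒linear d B∈𝓑 C∈𝓑 x≢y x∈B y∈B x∈C y∈C =
  constant-of-length (IsBlockSet.atMostOnce d _ _ x≢y)
    (∈-filter⁺ _ B∈𝓑 (x∈B , y∈B)) (∈-filter⁺ _ C∈𝓑 (x∈C , y∈C))

allPairs-lookup : {A : Set} {R : A → A → Set} {xs : List A} → AllPairs R xs →
                  ∀ {i j} → toℕ i < toℕ j → R (List.lookup xs i) (List.lookup xs j)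
allPairs-lookup (Rx ∷ _)  {zero}  {suc j} _         = All.lookup Rx (∈-lookup j)
allPairs-lookup (_ ∷ Rxs) {suc i} {suc j} (s≤s i<j) = allPairs-lookup Rxs i<j

-- Assign to each block an index whose point it contains. With more than `k` blocks, two would share
-- an index by the pigeonhole principle, hence a point.
disjoint-length : {P : List (Subset v)} (f : Fin k → Fin v) →
                  AllPairs (λ B C → Empty (B ∩ C)) P →
                  (∀ {B} → B ∈ P → ∃[ i ] f i ∈ₛ B) → length P ≤ k
disjoint-length {P = P} f disjoint meet = ℕ.≮⇒≥ λ k<P →
  let g = λ j → proj₁ (meet (∈-lookup {xs = P} j))
      (i , j , i<j , eq) = Fin.pigeonhole k<P g
  in allPairs-lookup disjoint i<j (f (g i) , Subset.x∈p∩q⁺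
       ( proj₂ (meet (∈-lookup i))
       , subst (λ z → f z ∈ₛ List.lookup P j) (sym eq) (proj₂ (meet (∈-lookup j)))))

length-cartesianProduct : {A B : Set} (xs : List A) (ys : List B) →
                          length (cartesianProduct xs ys) ≡ length xs * length ys
length-cartesianProduct []       ys = refl
length-cartesianProduct (x ∷ xs) ys = trans (List.length-++ (map (x ,_) ys))
  (cong₂ _+_ (List.length-map (x ,_) ys) (length-cartesianProduct xs ys))

∣++∣ : (p : Subset m) (q : Subset n) → ∣ p Vec.++ q ∣ ≡ ∣ p ∣ + ∣ q ∣
∣++∣ Vec.[]            q = refl
∣++∣ (inside  Vec.∷ p) q = cong ℕ.suc (∣++∣ p q)
∣++∣ (outside Vec.∷ p) q = ∣++∣ p q

-- Phrased through `splitAt`, so that one `with` on it reduces both this conclusion and `site`.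
∈-++⁻′ : (p : Subset m) {q : Subset n} {x : Fin (m + n)} →
         x ∈ₛ p Vec.++ q → [ _∈ₛ p , _∈ₛ q ]′ (splitAt m x)
∈-++⁻′ Vec.[] x∈ = x∈
∈-++⁻′ (_ Vec.∷ p) {x = zero} Vec.here = Vec.here
∈-++⁻′ {m = ℕ.suc m} (_ Vec.∷ p) {x = suc x} (Vec.there x∈) with splitAt m x | ∈-++⁻′ p x∈
... | inj₁ _ | x∈p = Vec.there x∈p
... | inj₂ _ | x∈q = x∈q

∈-++⁺ʳ′ : (p : Subset m) {q : Subset n} {x : Fin n} → x ∈ₛ q → (m ↑ʳ x) ∈ₛ p Vec.++ q
∈-++⁺ʳ′ Vec.[]      x∈q = x∈q
∈-++⁺ʳ′ (_ Vec.∷ p) x∈q = Vec.there (∈-++⁺ʳ′ p x∈q)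

⁅⁆-injective : {x y : Fin n} → ⁅ x ⁆ ≡ ⁅ y ⁆ → x ≡ y
⁅⁆-injective {x = x} {y} eq = Subset.x∈⁅y⁆⇒x≡y y (subst (x ∈ₛ_) eq (Subset.x∈⁅x⁆ x))

⁅x⁆≢⊥ : {x : Fin n} → ⁅ x ⁆ ≢ ⊥
⁅x⁆≢⊥ {x = x} eq = Subset.∉⊥ (subst (x ∈ₛ_) eq (Subset.x∈⁅x⁆ x))

-- The packing obtained from an idempotent transversal design.

module Packing {m ρ : ℕ} (td : IdempotentTD (Fin m)) (1≤ρ : 1 ≤ ρ) (ρ≤m : ρ ≤ m) where
  open IdempotentTD td

  size : ℕ
  size = m + (m + (m + ρ))

  class : Fin ρ → Fin m
  class c = inject≤ c ρ≤m

  class-injective : ∀ {c d} → class c ≡ class d → c ≡ d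
  class-injective = Fin.inject≤-injective ρ≤m ρ≤m _ _

  Site : Set
  Site = Fin m ⊎ (Fin m ⊎ (Fin m ⊎ Fin ρ))

  site : Fin size → Site
  site p = Sum.map₂ (Sum.map₂ (splitAt m) ∘ splitAt m) (splitAt m p)

  splitAt-injective : ∀ {k} {p r : Fin (m + k)} → splitAt m p ≡ splitAt m r → p ≡ r
  splitAt-injective {k} {p} {r} eq = trans (sym (Fin.join-splitAt m k p))
    (trans (cong (Fin.join m k) eq) (Fin.join-splitAt m k r))

  map₂-injective : {A B C : Set} {f : B → C} → (∀ {x y} → f x ≡ f y → x ≡ y) →
                   {s t : A ⊎ B} → Sum.map₂ f s ≡ Sum.map₂ f t → s ≡ t
  map₂-injective inj {inj₁ _} {inj₁ _} refl = refl
  map₂-injective inj {inj₂ _} {inj₂ _} eq   = cong inj₂ (inj (Sum.inj₂-injective eq))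

  site-injective : ∀ {p r} → site p ≡ site r → p ≡ r
  site-injective = splitAt-injective ∘
    map₂-injective (splitAt-injective ∘ map₂-injective splitAt-injective)

  -- Level 0 of the transversal design, cut down to ρ points, holds the points
  -- that complete the triples of the ρ parallel classes.
  level : Site → Fin 4
  level (inj₁ _)               = 1F
  level (inj₂ (inj₁ _))        = 2F
  level (inj₂ (inj₂ (inj₁ _))) = 3F
  level (inj₂ (inj₂ (inj₂ _))) = 0F

  value : Site → Fin m
  value (inj₁ a)               = a
  value (inj₂ (inj₁ a))        = a
  value (inj₂ (inj₂ (inj₁ a))) = a
  value (inj₂ (inj₂ (inj₂ c))) = class c

  coordinates-injective : ∀ s t → level s ≡ level t → value s ≡ value t → s ≡ t
  coordinates-injective (inj₁ _) (inj₁ _) _ refl = refl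
  coordinates-injective (inj₂ (inj₁ _)) (inj₂ (inj₁ _)) _ refl = refl
  coordinates-injective (inj₂ (inj₂ (inj₁ _))) (inj₂ (inj₂ (inj₁ _))) _ refl = refl
  coordinates-injective (inj₁ _) (inj₂ (inj₁ _)) ()
  coordinates-injective (inj₁ _) (inj₂ (inj₂ (inj₁ _))) ()
  coordinates-injective (inj₁ _) (inj₂ (inj₂ (inj₂ _))) ()
  coordinates-injective (inj₂ (inj₁ _)) (inj₂ (inj₂ (inj₁ _))) ()
  coordinates-injective (inj₂ (inj₁ _)) (inj₂ (inj₂ (inj₂ _))) ()
  coordinates-injective (inj₂ (inj₂ (inj₂ _))) (inj₂ (inj₂ (inj₂ _))) _ eq =
    cong (inj₂ ∘ inj₂ ∘ inj₂) (class-injective eq)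

  ideal : Fin ρ → Fin size
  ideal c = m ↑ʳ (m ↑ʳ (m ↑ʳ c))

  blockSubset : Fin ρ × Fin m → Subset size
  blockSubset (c , x) =
    ⁅ block (class c) x 1F ⁆ Vec.++ (⁅ block (class c) x 2F ⁆ Vec.++
    (⁅ block (class c) x 3F ⁆ Vec.++ ⁅ c ⁆))

  idealSubset : Subset ρ → Subset size
  idealSubset B = ⊥ {m} Vec.++ (⊥ {m} Vec.++ (⊥ {m} Vec.++ B))

  -- Membership in any of the four parts becomes one equation in the design, so linearity reduces to
  -- `determined`.
  ∈-blockSubset : ∀ c x {p} → p ∈ₛ blockSubset (c , x) →
                  block (class c) x (level (site p)) ≡ value (site p)
  ∈-blockSubset c x {p} p∈ with splitAt m p | ∈-++⁻′ ⁅ block (class c) x 1F ⁆ p∈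
  ... | inj₁ a | a∈ = sym (Subset.x∈⁅y⁆⇒x≡y _ a∈)
  ... | inj₂ p′ | p′∈ with splitAt m p′ | ∈-++⁻′ ⁅ block (class c) x 2F ⁆ p′∈
  ...   | inj₁ a | a∈ = sym (Subset.x∈⁅y⁆⇒x≡y _ a∈)
  ...   | inj₂ p″ | p″∈ with splitAt m p″ | ∈-++⁻′ ⁅ block (class c) x 3F ⁆ p″∈
  ...     | inj₁ a | a∈ = sym (Subset.x∈⁅y⁆⇒x≡y _ a∈)
  ...     | inj₂ d | d∈ = trans (block-zero _ _) (cong class (sym (Subset.x∈⁅y⁆⇒x≡y _ d∈)))

  ∈-idealSubset : ∀ {B p} → p ∈ₛ idealSubset B → ∃[ c ] site p ≡ inj₂ (inj₂ (inj₂ c)) × c ∈ₛ B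
  ∈-idealSubset {B} {p} p∈ with splitAt m p | ∈-++⁻′ (⊥ {m}) p∈
  ... | inj₁ a | a∈ = ⊥-elim (Subset.∉⊥ a∈)
  ... | inj₂ p′ | p′∈ with splitAt m p′ | ∈-++⁻′ (⊥ {m}) p′∈
  ...   | inj₁ a | a∈ = ⊥-elim (Subset.∉⊥ a∈)
  ...   | inj₂ p″ | p″∈ with splitAt m p″ | ∈-++⁻′ (⊥ {m}) p″∈
  ...     | inj₁ a | a∈ = ⊥-elim (Subset.∉⊥ a∈)
  ...     | inj₂ d | d∈ = d , refl , d∈

  ideal∈ : ∀ {B c} (p q r : Subset m) → c ∈ₛ B → ideal c ∈ₛ p Vec.++ (q Vec.++ (r Vec.++ B))
  ideal∈ p q r c∈B = ∈-++⁺ʳ′ p (∈-++⁺ʳ′ q (∈-++⁺ʳ′ r c∈B))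

  blockSubset-injective : ∀ {cx dy} → blockSubset cx ≡ blockSubset dy → cx ≡ dy
  blockSubset-injective {c , x} {d , y} eq =
    let (p , eq₁) = Vec.++-injective ⁅ block (class c) x 1F ⁆ ⁅ block (class d) y 1F ⁆ eq
        (q , eq₂) = Vec.++-injective ⁅ block (class c) x 2F ⁆ ⁅ block (class d) y 2F ⁆ eq₁
        (r , s)   = determined 1F 2F (λ ()) (⁅⁆-injective p) (⁅⁆-injective q)
    in cong₂ _,_ (class-injective r) s

  idealSubset-injective : ∀ {B C} → idealSubset B ≡ idealSubset C → B ≡ C
  idealSubset-injective eq =
    Vec.++-injectiveʳ (⊥ {m}) ⊥ (Vec.++-injectiveʳ (⊥ {m}) ⊥ (Vec.++-injectiveʳ (⊥ {m}) ⊥ eq))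

  ∣blockSubset∣ : ∀ cx → ∣ blockSubset cx ∣ ≡ 4
  ∣blockSubset∣ (c , x) =
    quadruple (block (class c) x 1F) (block (class c) x 2F) (block (class c) x 3F)
    where
    quadruple : ∀ x y z → ∣ ⁅ x ⁆ Vec.++ (⁅ y ⁆ Vec.++ (⁅ z ⁆ Vec.++ ⁅ c ⁆)) ∣ ≡ 4
    quadruple x y z
      rewrite ∣++∣ ⁅ x ⁆ (⁅ y ⁆ Vec.++ (⁅ z ⁆ Vec.++ ⁅ c ⁆))
            | ∣++∣ ⁅ y ⁆ (⁅ z ⁆ Vec.++ ⁅ c ⁆) | ∣++∣ ⁅ z ⁆ ⁅ c ⁆
            | Subset.∣⁅x⁆∣≡1 x | Subset.∣⁅x⁆∣≡1 y | Subset.∣⁅x⁆∣≡1 z | Subset.∣⁅x⁆∣≡1 c = refl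

  ∣idealSubset∣ : ∀ B → ∣ idealSubset B ∣ ≡ ∣ B ∣
  ∣idealSubset∣ B
    rewrite ∣++∣ (⊥ {m}) (⊥ {m} Vec.++ (⊥ {m} Vec.++ B))
          | ∣++∣ (⊥ {m}) (⊥ {m} Vec.++ B) | ∣++∣ (⊥ {m}) B
          | Subset.∣⊥∣≡0 m = refl

  optimal : List (Subset ρ)
  optimal = proj₁ (D-attained ρ 4)

  optimal-blockSet : IsBlockSet ρ 4 optimal
  optimal-blockSet = proj₁ (proj₂ (D-attained ρ 4))

  indices : List (Fin ρ × Fin m)
  indices = cartesianProduct (allFin ρ) (allFin m)

  𝓑 : List (Subset size)
  𝓑 = map blockSubset indices ++ map idealSubset optimal

  data BlockView : Subset size → Set where
    triple : ∀ c x → BlockView (blockSubset (c , x))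
    pure   : ∀ {B} → B ∈ optimal → BlockView (idealSubset B)

  view : ∀ {B} → B ∈ 𝓑 → BlockView B
  view B∈ with ∈-++⁻ (map blockSubset indices) B∈
  ... | inj₁ p with (c , x) , _ , refl ← ∈-map⁻ blockSubset p = triple c x
  ... | inj₂ p with _ , B∈ , refl ← ∈-map⁻ idealSubset p = pure B∈

  indices-unique : Unique indices
  indices-unique = Unique.cartesianProduct⁺ (Unique.allFin⁺ ρ) (Unique.allFin⁺ m)

  𝓑-unique : Unique 𝓑
  𝓑-unique = Unique.++⁺
    (Unique.map⁺ blockSubset-injective indices-unique)
    (Unique.map⁺ idealSubset-injective (IsBlockSet.unique optimal-blockSet))
    λ (p , q) →
      let ((c , x) , _ , eq) = ∈-map⁻ blockSubset p
          (_ , _ , eq′)      = ∈-map⁻ idealSubset q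
      in ⁅x⁆≢⊥ {x = block (class c) x 1F}
           (Vec.++-injectiveˡ ⁅ block (class c) x 1F ⁆ ⊥ (trans (sym eq) eq′))

  distinct-levels : ∀ c x {p r} → p ≢ r → p ∈ₛ blockSubset (c , x) → r ∈ₛ blockSubset (c , x) →
                    level (site p) ≢ level (site r)
  distinct-levels c x {p} {r} p≢r p∈ r∈ eq =
    p≢r (site-injective (coordinates-injective (site p) (site r) eq
      (trans (sym (∈-blockSubset c x p∈)) (trans (cong (block (class c) x) eq)
        (∈-blockSubset c x r∈)))))

  -- All points of an ideal subset lie on level 0, where a transversal block has only one point.
  triple-pure : ∀ c x {B} {p r} → p ≢ r → p ∈ₛ blockSubset (c , x) → r ∈ₛ blockSubset (c , x) →
                p ∈ₛ idealSubset B → ¬ r ∈ₛ idealSubset B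
  triple-pure c x p≢r p∈ r∈ p∈′ r∈′ =
    let (_ , s , _) = ∈-idealSubset p∈′
        (_ , t , _) = ∈-idealSubset r∈′
    in distinct-levels c x p≢r p∈ r∈ (trans (cong level s) (sym (cong level t)))

  𝓑-linear : Linear 𝓑
  𝓑-linear {x = p} {y = r} B∈ C∈ with view B∈ | view C∈
  ... | triple c x | triple d y = λ p≢r p∈ r∈ p∈′ r∈′ →
    let (eq , eq′) = determined (level (site p)) (level (site r)) (distinct-levels c x p≢r p∈ r∈)
          (trans (∈-blockSubset c x p∈) (sym (∈-blockSubset d y p∈′)))
          (trans (∈-blockSubset c x r∈) (sym (∈-blockSubset d y r∈′)))
    in cong blockSubset (cong₂ _,_ (class-injective eq) eq′)
  ... | triple c x | pure _ = λ p≢r p∈ r∈ p∈′ r∈′ → ⊥-elim (triple-pure c x p≢r p∈ r∈ p∈′ r∈′)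
  ... | pure _ | triple c x = λ p≢r p∈ r∈ p∈′ r∈′ → ⊥-elim (triple-pure c x p≢r p∈′ r∈′ p∈ r∈)
  ... | pure B∈ | pure C∈ = λ p≢r p∈ r∈ p∈′ r∈′ →
    let (i , si , i∈B)  = ∈-idealSubset p∈
        (j , sj , j∈B)  = ∈-idealSubset r∈
        (i′ , si′ , i∈C) = ∈-idealSubset p∈′
        (j′ , sj′ , j∈C) = ∈-idealSubset r∈′
    in cong idealSubset (blockSet⇒linear optimal-blockSet B∈ C∈
         (λ eq → p≢r (site-injective (trans si (trans (cong (inj₂ ∘ inj₂ ∘ inj₂) eq) (sym sj)))))
         i∈B j∈B
         (subst (_∈ₛ _) (ideal-injective (trans (sym si′) si)) i∈C)
         (subst (_∈ₛ _) (ideal-injective (trans (sym sj′) sj)) j∈C))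
    where
    ideal-injective : ∀ {c d : Fin ρ} →
      _≡_ {A = Site} (inj₂ (inj₂ (inj₂ c))) (inj₂ (inj₂ (inj₂ d))) → c ≡ d
    ideal-injective refl = refl

  𝓑-uniform : All (λ B → ∣ B ∣ ≡ 4) 𝓑
  𝓑-uniform = All.++⁺
    (All.map⁺ (All.universal ∣blockSubset∣ indices))
    (All.map⁺ (All.map (trans (∣idealSubset∣ _)) (IsBlockSet.uniform optimal-blockSet)))

  isPacking : IsPacking size 4 𝓑
  isPacking = record
    { 2≤k = s≤s (s≤s z≤n)
    ; k≤v = ℕ.+-mono-≤ 1≤m (ℕ.+-mono-≤ 1≤m (ℕ.+-mono-≤ 1≤m 1≤ρ))
    ; isBlockSet = record
      { unique     = 𝓑-unique
      ; uniform    = 𝓑-uniform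
      ; atMostOnce = linear⇒atMostOnce 𝓑-unique 𝓑-linear
      }
    }
    where
    1≤m : 1 ≤ m
    1≤m = ℕ.≤-trans 1≤ρ ρ≤m

  𝓑-length : length 𝓑 ≡ ρ * m + D ρ 4
  𝓑-length = trans (List.length-++ (map blockSubset indices)) (cong₂ _+_
    (trans (List.length-map blockSubset indices)
      (trans (length-cartesianProduct (allFin ρ) (allFin m))
        (cong₂ _*_ (List.length-tabulate {n = ρ} id) (List.length-tabulate {n = m} id))))
    (trans (List.length-map idealSubset optimal) (proj₂ (proj₂ (D-attained ρ 4)))))

  -- The upper bound for PPCs rests on this: disjoint blocks use different points among the `ρ`
  -- ideal ones. A block of the optimal packing has size 4, so it is nonempty.
  meets-ideal : ∀ {B} → B ∈ 𝓑 → ∃[ c ] ideal c ∈ₛ B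
  meets-ideal B∈ with view B∈
  ... | triple c x = c , ideal∈
    ⁅ block (class c) x 1F ⁆ ⁅ block (class c) x 2F ⁆ ⁅ block (class c) x 3F ⁆ (Subset.x∈⁅x⁆ c)
  ... | pure {B} B∈ with Subset.nonempty? B
  ...   | yes (c , c∈B) = c , ideal∈ ⊥ ⊥ ⊥ c∈B
  ...   | no empty = ⊥-elim (ℕ.0≢1+n (trans (sym (Subset.∣⊥∣≡0 ρ))
            (trans (cong ∣_∣ (sym (Subset.Empty-unique empty)))
              (All.lookup (IsBlockSet.uniform optimal-blockSet) B∈))))

  -- By idempotence these come from the constant blocks with values `class c`, which are pairwise
  -- disjoint.
  diagonal : List (Subset size)
  diagonal = map (λ c → blockSubset (c , class c)) (allFin ρ)

  diagonal-isPPC : IsPPC 𝓑 diagonal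
  diagonal-isPPC = record
    { unique   = Unique.map⁺ (cong proj₁ ∘ blockSubset-injective) (Unique.allFin⁺ ρ)
    ; blocks   = λ B∈ → let (c , _ , eq) = ∈-map⁻ (λ c → blockSubset (c , class c)) B∈ in
        subst (_∈ 𝓑) (sym eq) (∈-++⁺ˡ (∈-map⁺ blockSubset
          (∈-cartesianProduct⁺ (∈-allFin c) (∈-allFin (class c)))))
    ; disjoint = AllPairs.map⁺ (AllPairs.map disjoint (Unique.allFin⁺ ρ))
    }
    where
    disjoint : ∀ {c d} → c ≢ d → Empty (blockSubset (c , class c) ∩ blockSubset (d , class d))
    disjoint {c} {d} c≢d (p , p∈∩) =
      let (p∈ , p∈′) = Subset.x∈p∩q⁻ (blockSubset (c , class c)) (blockSubset (d , class d)) p∈∩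
      in c≢d (class-injective
        (trans (sym (idempotent (class c) (level (site p))))
          (trans (trans (∈-blockSubset c (class c) p∈) (sym (∈-blockSubset d (class d) p∈′)))
            (idempotent (class d) (level (site p))))))

  largestPPC : LargestPPCHasSize 𝓑 ρ
  largestPPC =
    (diagonal , diagonal-isPPC ,
      trans (List.length-map _ (allFin ρ)) (List.length-tabulate {n = ρ} id)) ,
    λ (P , ppc , len) → ℕ.1+n≰n (subst (_≤ ρ) len
      (disjoint-length ideal (IsPPC.disjoint ppc) (meets-ideal ∘ IsPPC.blocks ppc)))

-- Idempotent designs of every odd order except 3.

units≡1 : ∀ c → Modular.SmallUnits (1 + 6 * c)
units≡1 c 1 _ _ = 1 , refl
units≡1 c 2 _ _ = 1 + 3 * c ,
  trans (cong (_% (1 + 6 * c)) (double c)) ([m+kn]%n≡m%n 1 1 (1 + 6 * c))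
  where
  double : ∀ c → 2 * (1 + 3 * c) ≡ 1 + 1 * (1 + 6 * c)
  double = solve-∀
units≡1 c 3 _ _ = 1 + 4 * c ,
  trans (cong (_% (1 + 6 * c)) (triple c)) ([m+kn]%n≡m%n 1 2 (1 + 6 * c))
  where
  triple : ∀ c → 3 * (1 + 4 * c) ≡ 1 + 2 * (1 + 6 * c)
  triple = solve-∀
units≡1 c (suc (suc (suc (suc _)))) _ (s≤s (s≤s (s≤s ())))

units≡5 : ∀ c → Modular.SmallUnits (5 + 6 * c)
units≡5 c 1 _ _ = 1 , refl
units≡5 c 2 _ _ = 3 + 3 * c ,
  trans (cong (_% (5 + 6 * c)) (double c)) ([m+kn]%n≡m%n 1 1 (5 + 6 * c))
  where
  double : ∀ c → 2 * (3 + 3 * c) ≡ 1 + 1 * (5 + 6 * c)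
  double = solve-∀
units≡5 c 3 _ _ = 2 + 2 * c ,
  trans (cong (_% (5 + 6 * c)) (triple c)) ([m+kn]%n≡m%n 1 1 (5 + 6 * c))
  where
  triple : ∀ c → 3 * (2 + 2 * c) ≡ 1 + 1 * (5 + 6 * c)
  triple = solve-∀
units≡5 c (suc (suc (suc (suc _)))) _ (s≤s (s≤s (s≤s ())))

td≡1 : ∀ c → IdempotentTD (Fin (1 + 6 * c))
td≡1 c = develop (progressions (units≡1 c))
  where open Modular (1 + 6 * c)

td≡5 : ∀ c → IdempotentTD (Fin (5 + 6 * c))
td≡5 c = develop (progressions (units≡5 c))
  where open Modular (5 + 6 * c)

-- Let c = 4a + r, so that the order is 24a + 6r + 3. For r = 0, 1, 2, 3 the choice w = 7, 5, 11, 1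
-- gives q = 6a - 1, 6a + 1, 6a + 1, 6a + 5, which is coprime to 6. The orders treated separately
-- are those with q < w.
td≡3 : ∀ c → c ≢ 0 → IdempotentTD (Fin (3 + 6 * c))
td≡3 c c≢0 with c divMod 4
... | result zero          0F refl = ⊥-elim (c≢0 refl)
... | result 1             0F refl = td27
... | result (suc (suc a)) 0F refl = subst (λ m → IdempotentTD (Fin m)) (size a)
  (truncated-td (5 + 6 * suc a) 7 (units≡5 (suc a))
    (ℕ.≤-trans (ℕ.m≤m+n 7 (4 + 6 * a)) (ℕ.≤-reflexive (bound a))) (td≡5 0) (td≡1 1))
  where
  size : ∀ a → 4 * (5 + 6 * suc a) + 7 ≡ 3 + 6 * (0 + suc (suc a) * 4)
  size = solve-∀
  bound : ∀ a → 7 + (4 + 6 * a) ≡ 5 + 6 * suc a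
  bound = solve-∀
... | result zero    1F refl = td9
... | result (suc a) 1F refl = subst (λ m → IdempotentTD (Fin m)) (size a)
  (truncated-td (1 + 6 * suc a) 5 (units≡1 (suc a))
    (ℕ.≤-trans (ℕ.m≤m+n 5 (2 + 6 * a)) (ℕ.≤-reflexive (bound a))) (td≡5 0) (td≡5 0))
  where
  size : ∀ a → 4 * (1 + 6 * suc a) + 5 ≡ 3 + 6 * (1 + suc a * 4)
  size = solve-∀
  bound : ∀ a → 5 + (2 + 6 * a) ≡ 1 + 6 * suc a
  bound = solve-∀
... | result 0 2F refl = td15
... | result 1 2F refl = td39
... | result (suc (suc a)) 2F refl = subst (λ m → IdempotentTD (Fin m)) (size a)
  (truncated-td (1 + 6 * suc (suc a)) 11 (units≡1 (suc (suc a)))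
    (ℕ.≤-trans (ℕ.m≤m+n 11 (2 + 6 * a)) (ℕ.≤-reflexive (bound a))) (td≡5 0) (td≡5 1))
  where
  size : ∀ a → 4 * (1 + 6 * suc (suc a)) + 11 ≡ 3 + 6 * (2 + suc (suc a) * 4)
  size = solve-∀
  bound : ∀ a → 11 + (2 + 6 * a) ≡ 1 + 6 * suc (suc a)
  bound = solve-∀
... | result a 3F refl = subst (λ m → IdempotentTD (Fin m)) (size a)
  (truncated-td (5 + 6 * a) 1 (units≡5 a) (s≤s z≤n) (td≡5 0) (td≡1 0))
  where
  size : ∀ a → 4 * (5 + 6 * a) + 1 ≡ 3 + 6 * (3 + a * 4)
  size = solve-∀

-- The residue of `h` modulo 3 fixes that of `1 + 2 * h` modulo 6. In order 3 any two of the nine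
-- blocks meet, so there is no parallel class.
odd-td : ∀ h → h ≢ 1 → IdempotentTD (Fin (1 + 2 * h))
odd-td h h≢1 with h divMod 3
... | result c 0F refl = subst (λ m → IdempotentTD (Fin m)) (size c) (td≡1 c)
  where
  size : ∀ c → 1 + 6 * c ≡ 1 + 2 * (0 + c * 3)
  size = solve-∀
... | result c 1F refl = subst (λ m → IdempotentTD (Fin m)) (size c)
  (td≡3 c λ { refl → h≢1 refl })
  where
  size : ∀ c → 3 + 6 * c ≡ 1 + 2 * (1 + c * 3)
  size = solve-∀
... | result c 2F refl = subst (λ m → IdempotentTD (Fin m)) (size c) (td≡5 c)
  where
  size : ∀ c → 5 + 6 * c ≡ 1 + 2 * (2 + c * 3)
  size = solve-∀

-- From designs of order n/3 to packings on n + ρ points.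

packing : ∀ {n m ρ} → n ≡ m * 3 → IdempotentTD (Fin m) → 1 ≤ ρ → ρ ≤ m →
  ∃[ 𝓑 ] IsPacking (n + ρ) 4 𝓑 × length 𝓑 ≡ (ρ * n) / 3 + D ρ 4 × LargestPPCHasSize 𝓑 ρ
packing {m = m} {ρ} refl td 1≤ρ ρ≤m = subst Result (sum m ρ)
  (𝓑 , isPacking , trans 𝓑-length (cong (_+ D ρ 4) (sym quotient)) , largestPPC)
  where
  open Packing td 1≤ρ ρ≤m
  Result : ℕ → Set
  Result v = ∃[ 𝓑 ] IsPacking v 4 𝓑 × length 𝓑 ≡ (ρ * (m * 3)) / 3 + D ρ 4 × LargestPPCHasSize 𝓑 ρ
  sum : ∀ m ρ → m + (m + (m + ρ)) ≡ m * 3 + ρ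
  sum = solve-∀
  quotient : (ρ * (m * 3)) / 3 ≡ ρ * m
  quotient = trans (cong (_/ 3) (sym (ℕ.*-assoc ρ m 3))) (m*n/n≡m (ρ * m) 3)

theorem2p3 : (n ρ : ℕ) → 1 ≤ n → n % 6 ≡ 3 →
    n ∉ (9 ∷ 15 ∷ 21 ∷ 141 ∷ 153 ∷ 165 ∷ 177 ∷ 189 ∷ 231 ∷ 249 ∷ 261 ∷ 285 ∷ 351 ∷ 357 ∷ []) →
    1 ≤ ρ → ρ ≤ n / 3 →
    ∃[ 𝓑 ] IsPacking (n + ρ) 4 𝓑 × length 𝓑 ≡ (ρ * n) / 3 + D ρ 4 × LargestPPCHasSize 𝓑 ρ
theorem2p3 n ρ _ n%6≡3 n∉ 1≤ρ ρ≤n/3 = packing n≡3m (odd-td h h≢1) 1≤ρ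
  (subst (ρ ≤_) (trans (cong (_/ 3) n≡3m) (m*n/n≡m (1 + 2 * h) 3)) ρ≤n/3)
  where
  h : ℕ
  h = n / 6
  factor : ∀ h → 3 + h * 6 ≡ (1 + 2 * h) * 3
  factor = solve-∀
  n≡3m : n ≡ (1 + 2 * h) * 3
  n≡3m = trans (m≡m%n+[m/n]*n n 6) (trans (cong (_+ h * 6) n%6≡3) (factor h))
  h≢1 : h ≢ 1
  -- The value `h = 1` corresponds to n = 9.
  h≢1 h≡1 = n∉ (here (trans n≡3m (cong (λ h → (1 + 2 * h) * 3) h≡1)))
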